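{- Let $(T,D)$ be a predominated tree. Staller wins the MBD game on $(T,D)$ if and only if $T$ contains a substructure $F\in\mathcal S$ such that $X(F)\cap D=\emptyset$.
   Context: A predominated graph is a pair $(G,D)$ with $G$ a finite simple graph and $D\subseteq V(G)$. In the MBD game on $(G,D)$, Staller and Dominator alternately claim unclaimed vertices of $V(G)$ (including vertices of $D$), Staller first, until all vertices are claimed; Staller wins if she claims all of $N_G[v]$ for some $v\in V(G)\setminus D$, and Dominator wins otherwise. For a tree $T$, $S(T)$ is obtained by subdividing each edge of $T$ exactly once; $\mathcal S=\{S(T):T\text{ a tree}\}$ and $X(S(T))=V(T)$ (with $S(P_1)=P_1$, $X(P_1)=V(P_1)$). $F\in\mathcal S$ is a substructure in $G$ if $F$ is a subgraph of $G$ and $\deg_G(v)=\deg_F(v)$ for every $v\in X(F)$. -}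

module Defs where

open import Data.Bool.Base using (Bool; true; false; T; _∨_)
open import Data.Fin.Base using (Fin; zero; suc; inject₁; fromℕ; _<_)
open import Data.Fin.Properties using (_≟_)
open import Data.Fin.Subset using (Subset; _∈_; _∉_; _∪_; ⁅_⁆; ∣_∣)
open import Data.Maybe.Base using (Maybe; just; nothing)
open import Data.Nat.Base using (ℕ; _+_)
open import Data.Product.Base using (∃; _×_; proj₁)
open import Data.Sum.Base using (_⊎_; inj₁; inj₂)
open import Data.Vec.Base using (Vec; lookup; replicate; tabulate; _[_]≔_)
open import Function.Bundles using (_↔_; Inverse)
open import Function.Definitions using (Injective)
open import Relation.Binary.Construct.Closure.ReflexiveTransitive using (Star)
open import Relation.Binary.PropositionalEquality using (_≡_; refl)
open import Relation.Nullary using (¬_; does)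

-- Adjacency is Bool-valued so that `T (adj u v)` is a proposition; this is
-- what makes `Edge` below have exactly one element per edge.
record Graph (V : Set) : Set where
  field
    adj        : V → V → Bool
    adj-sym    : ∀ u v → adj u v ≡ adj v u
    adj-irrefl : ∀ v → adj v v ≡ false

  Adj : V → V → Set
  Adj u v = T (adj u v)

open Graph public

record _≅_ {V W : Set} (G : Graph V) (H : Graph W) : Set where
  field
    bijection : V ↔ W
    adj-≡     : ∀ u v → adj G u v ≡ adj H (Inverse.to bijection u) (Inverse.to bijection v)

  to : V → W
  to = Inverse.to bijection

record Cycle {V : Set} (G : Graph V) : Set where
  field
    k         : ℕ
    vertex    : Fin (3 + k) → V
    injective : Injective _≡_ _≡_ vertex
    step      : ∀ (i : Fin (2 + k)) → Adj G (vertex (inject₁ i)) (vertex (suc i))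
    close     : Adj G (vertex (fromℕ (2 + k))) (vertex zero)

record IsTree {V : Set} (G : Graph V) : Set where
  field
    nonempty  : V
    connected : ∀ u v → Star (Adj G) u v
    acyclic   : ¬ Cycle G

openNbhd : ∀ {n} → Graph (Fin n) → Fin n → Subset n
openNbhd G v = tabulate (adj G v)

closedNbhd : ∀ {n} → Graph (Fin n) → Fin n → Subset n
closedNbhd G v = ⁅ v ⁆ ∪ openNbhd G v

deg : ∀ {n} → Graph (Fin n) → Fin n → ℕ
deg G v = ∣ openNbhd G v ∣

record Edge {n} (G : Graph (Fin n)) : Set where
  constructor edge
  field
    src tgt  : Fin n
    ordered  : src < tgt
    adjacent : Adj G src tgt

endpoint : ∀ {n} {G : Graph (Fin n)} → Fin n → Edge G → Bool
endpoint v e = does (v ≟ Edge.src e) ∨ does (v ≟ Edge.tgt e)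

-- S(G): `inj₁ v` is an original vertex, `inj₂ e` the vertex subdividing e.
subdivide : ∀ {n} (G : Graph (Fin n)) → Graph (Fin n ⊎ Edge G)
subdivide {n} G = record { adj = a ; adj-sym = s ; adj-irrefl = i }
  where
  a : Fin n ⊎ Edge G → Fin n ⊎ Edge G → Bool
  a (inj₁ _) (inj₁ _) = false
  a (inj₁ v) (inj₂ e) = endpoint v e
  a (inj₂ e) (inj₁ v) = endpoint v e
  a (inj₂ _) (inj₂ _) = false

  s : ∀ x y → a x y ≡ a y x
  s (inj₁ _) (inj₁ _) = refl
  s (inj₁ _) (inj₂ _) = refl
  s (inj₂ _) (inj₁ _) = refl
  s (inj₂ _) (inj₂ _) = refl

  i : ∀ x → a x x ≡ false
  i (inj₁ _) = refl
  i (inj₂ _) = refl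

-- A not necessarily induced subgraph.  The edges are kept as a graph on the
-- ambient vertex set, so `deg edges v` is the degree of v in the subgraph.
record Subgraph {n} (G : Graph (Fin n)) : Set where
  field
    vertices  : Subset n
    edges     : Graph (Fin n)
    edges-⊆   : ∀ {u v} → Adj edges u v → Adj G u v
    endpoints : ∀ {u v} → Adj edges u v → u ∈ vertices × v ∈ vertices

  graph : Graph (∃ λ v → v ∈ vertices)
  graph = record
    { adj        = λ u v → adj edges (proj₁ u) (proj₁ v)
    ; adj-sym    = λ u v → adj-sym edges (proj₁ u) (proj₁ v)
    ; adj-irrefl = λ v → adj-irrefl edges (proj₁ v)
    }

-- F ∈ 𝒮: F is, up to isomorphism, S(T) for a tree T.
record 𝒮 {n} {G : Graph (Fin n)} (F : Subgraph G) : Set where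
  field
    order  : ℕ
    tree   : Graph (Fin order)
    isTree : IsTree tree
    iso    : subdivide tree ≅ Subgraph.graph F

  -- X(F), the vertices of F corresponding to V(T).
  X : Fin n → Set
  X v = ∃ λ u → proj₁ (_≅_.to iso (inj₁ u)) ≡ v

record Substructure {n} (G : Graph (Fin n)) : Set where
  field
    F     : Subgraph G
    F∈𝒮   : 𝒮 F
    deg-≡ : ∀ v → 𝒮.X F∈𝒮 v → deg G v ≡ deg (Subgraph.edges F) v

  X : Fin n → Set
  X = 𝒮.X F∈𝒮

data Player : Set where
  staller dominator : Player

Position : ℕ → Set
Position n = Vec (Maybe Player) n

Unclaimed : ∀ {n} → Position n → Fin n → Set
Unclaimed p x = lookup p x ≡ nothing

claim : ∀ {n} → Player → Fin n → Position n → Position n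
claim s x p = p [ x ]≔ just s

StallerClaimsNeighbourhood : ∀ {n} → Graph (Fin n) → Subset n → Position n → Set
StallerClaimsNeighbourhood G D p =
  ∃ λ v → v ∉ D × (∀ w → w ∈ closedNbhd G v → lookup p w ≡ just staller)

-- `StallerWinsFrom G D s p`: Staller has a winning strategy from position p
-- with player s to move.
data StallerWinsFrom {n} (G : Graph (Fin n)) (D : Subset n) : Player → Position n → Set where
  game-over       : ∀ {s p} → (∀ x → ¬ Unclaimed p x) →
                    StallerClaimsNeighbourhood G D p →
                    StallerWinsFrom G D s p
  staller-moves   : ∀ {p} x → Unclaimed p x →
                    StallerWinsFrom G D dominator (claim staller x p) →
                    StallerWinsFrom G D staller p
  dominator-moves : ∀ {p} → ∃ (Unclaimed p) →
                    (∀ x → Unclaimed p x → StallerWinsFrom G D staller (claim dominator x p)) →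
                    StallerWinsFrom G D dominator p

StallerWins : ∀ {n} → Graph (Fin n) → Subset n → Set
StallerWins {n} G D = StallerWinsFrom G D staller (replicate n nothing)

{-# OPTIONS --safe #-}
-- Both sides are equivalent to: no matching of T covers V(T) ∖ D.  Given such a matching,
-- Dominator answers every claim of Staller by the mate of the claimed vertex.  Given a
-- substructure S(H), Staller peels off the leaves of H: she claims the vertex subdividing the edge
-- at a leaf x, which forces Dominator to claim x, until a single vertex of H is left.  A matching
-- or a substructure is found by removing a leaf l with neighbour p from T: if l ∉ D, match l with
-- p and remove both; if l ∈ D, remove l and add p to D, since p cannot be an original vertex of a
-- substructure and l can still be matched with p.  Choosing p with at most one non-leaf neighbour
-- ensures that at most one original vertex of a substructure of the rest is adjacent to p.
module Submission where

open import Defs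
open import Data.Bool.Base using (T)
open import Data.Bool.Properties using (T-∨; T-irrelevant)
open import Data.Fin.Base using (Fin; zero; suc; _<_; _>_; toℕ; inject₁; fromℕ)
open import Data.Fin.Induction using (>-wellFounded) renaming (<-wellFounded to <ᶠ-wellFounded)
open import Data.Fin.Properties using (_≟_; any?; all?; pigeonhole; toℕ-injective; toℕ-inject₁; toℕ-fromℕ; toℕ<n; inject₁-injective)
import Data.Fin.Properties as Fin
open import Data.Fin.Relation.Unary.Top using (view; ‵fromℕ; ‵inject₁)
open import Data.Fin.Subset using (Subset; Nonempty; _∈_; _∉_; _⊂_; _⊆_; _-_; _∪_; ⁅_⁆; ⊤; ∣_∣)
open import Data.Fin.Subset.Induction using (⊂-wellFounded)
open import Data.Fin.Subset.Properties using (_∈?_; nonempty?; ∈⊤; x∈⁅x⁆; x∈⁅y⁆⇒x≡y; p─q⊆p; x∈p∧x≢y⇒x∈p-y; x∈p⇒p-x⊂p; x∈p∪q⁻; p⊆p∪q; q⊆p∪q; ⊆-⊂-trans; p⊂q⇒∣p∣<∣q∣)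
open import Data.Maybe.Base using (just; nothing)
open import Data.Nat.Base as ℕ using (ℕ; zero; suc; _+_; _∸_; z<s; s<s)
open import Data.Nat.Induction using (<-wellFounded)
import Data.Nat.Properties as ℕ
open import Data.Product.Base using (Σ; ∃; ∃₂; _×_; _,_; proj₁; proj₂)
open import Data.Sum.Base as Sum using (_⊎_; inj₁; inj₂; [_,_]′)
open import Data.Vec.Base using (lookup; replicate; tabulate; _∷_; there)
open import Data.Vec.Properties using ([]=⇒lookup; lookup⇒[]=; lookup∘tabulate; tabulate-cong; lookup∘update; lookup∘update′; lookup-replicate)
open import Data.Vec.Properties.WithK using ([]=-irrelevant)
open import Function.Base using (_∘_; case_of_; id)
open import Function.Bundles using (Equivalence; Inverse; _⇔_; mk⇔; _↔_; mk↔ₛ′)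
open import Induction.WellFounded using (Acc; acc)
open import Relation.Binary.Construct.Closure.ReflexiveTransitive using (Star; ε; _◅_; _◅◅_; reverse)
open import Relation.Binary.Definitions using (tri<; tri≈; tri>)
open import Relation.Binary.PropositionalEquality using (_≡_; _≢_; refl; sym; trans; cong; cong₂; subst; subst₂; ≢-sym)
open import Relation.Nullary using (¬_; Dec; yes; no; does; contradiction)
open import Relation.Nullary.Decidable using (¬?; _×-dec_; _⊎-dec_; _→-dec_; T?; decidable-stable; dec-true; dec-false; does-⇔)
open import Relation.Unary using (Decidable)

-- Decidable subsets and adjacency

subset : ∀ {n} {P : Fin n → Set} → Decidable P → Subset n
subset P? = tabulate (does ∘ P?)

module _ {n} {P : Fin n → Set} (P? : Decidable P) where

  ∈-subset⁺ : ∀ {v} → P v → v ∈ subset P?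
  ∈-subset⁺ {v} Pv =
    lookup⇒[]= v _ (trans (lookup∘tabulate (does ∘ P?) v) (dec-true (P? v) Pv))

  ∈-subset⁻ : ∀ {v} → v ∈ subset P? → P v
  ∈-subset⁻ {v} v∈ with P? v | trans (sym (lookup∘tabulate (does ∘ P?) v)) ([]=⇒lookup v∈)
  ... | yes Pv | _  = Pv
  ... | no _   | ()

module _ {V : Set} (G : Graph V) where

  Adj-sym : ∀ {u v} → Adj G u v → Adj G v u
  Adj-sym {u} {v} = subst T (adj-sym G u v)

  Adj-irrefl : ∀ {v} → ¬ Adj G v v
  Adj-irrefl {v} = subst T (adj-irrefl G v)

  Adj⇒≢ : ∀ {u v} → Adj G u v → u ≢ v
  Adj⇒≢ uv refl = Adj-irrefl uv

-- Non-backtracking walks, cycles and leaves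

-- A closed stretch of a non-backtracking walk contains a cycle: shorten it
-- until its vertices are distinct.
module _ {n} (G : Graph (Fin n)) (walk : ℕ → Fin n)
         (step : ∀ i → Adj G (walk i) (walk (suc i)))
         (no-return : ∀ i → walk i ≢ walk (suc (suc i))) where

  closed-stretch⇒cycle : ∀ d i → Acc ℕ._<_ d → walk i ≡ walk (suc d + i) → Cycle G
  closed-stretch⇒cycle zero i _ eq = contradiction eq (Adj⇒≢ G (step i))
  closed-stretch⇒cycle (suc zero) i _ eq = contradiction eq (no-return i)
  closed-stretch⇒cycle d@(suc (suc k)) i (acc rs) eq
    -- The indices 0 to d omit the closing index `suc d`, so a repetition among them bounds a
    -- strictly shorter closed stretch.
    with any? (λ (a : Fin (suc d)) → any? (λ (b : Fin (suc d)) →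
           (toℕ a ℕ.<? toℕ b) ×-dec (walk (toℕ a + i) ≟ walk (toℕ b + i))))
  ... | yes (a , b , a<b , eq′) =
    closed-stretch⇒cycle d′ (toℕ a + i) (rs d′<d)
      (trans eq′ (cong walk (trans (cong (_+ i) b≡) (ℕ.+-assoc (suc d′) (toℕ a) i))))
    where
    d′ = toℕ b ∸ suc (toℕ a)
    b≡ : toℕ b ≡ suc d′ + toℕ a
    b≡ = trans (sym (ℕ.m∸n+n≡m a<b)) (ℕ.+-suc d′ (toℕ a))
    d′<d : d′ ℕ.< d
    d′<d = ℕ.≤-trans (subst (suc d′ ℕ.≤_) (sym b≡) (ℕ.m≤m+n (suc d′) (toℕ a)))
                     (ℕ.≤-pred (toℕ<n b))
  ... | no distinct = record
    { k         = k
    ; vertex    = vertex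
    ; injective = injective
    ; step      = λ j → subst (λ m → Adj G (walk (m + i)) (walk (suc (toℕ j) + i)))
                              (sym (toℕ-inject₁ j)) (step (toℕ j + i))
    ; close     = subst₂ (Adj G) (cong (λ m → walk (m + i)) (sym (toℕ-fromℕ d))) (sym eq)
                         (step (d + i))
    }
    where
    vertex : Fin (suc d) → Fin n
    vertex j = walk (toℕ j + i)
    injective : ∀ {a b} → vertex a ≡ vertex b → a ≡ b
    injective {a} {b} e with ℕ.<-cmp (toℕ a) (toℕ b)
    ... | tri< a<b _ _ = contradiction (a , b , a<b , e) distinct
    ... | tri≈ _ a≡b _ = toℕ-injective a≡b
    ... | tri> _ _ b<a = contradiction (b , a , b<a , sym e) distinct

  walk⇒cycle : Cycle G
  walk⇒cycle with i , j , i<j , eq ← pigeonhole (ℕ.n<1+n n) (walk ∘ toℕ) =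
    closed-stretch⇒cycle (toℕ j ∸ suc (toℕ i)) (toℕ i) (<-wellFounded _)
      (trans eq (cong walk (trans (sym (ℕ.m∸n+n≡m i<j)) (ℕ.+-suc (toℕ j ∸ suc (toℕ i)) (toℕ i)))))

module _ {n} (G : Graph (Fin n)) where

  -- All neighbours of v inside A coincide with p; p is arbitrary when there are none.
  OnlyNbr : Subset n → Fin n → Fin n → Set
  OnlyNbr A v p = ∀ y → y ∈ A → Adj G v y → y ≡ p

  Leaf : Subset n → Fin n → Set
  Leaf A v = ∃ (OnlyNbr A v)

  onlyNbr? : ∀ A v p → Dec (OnlyNbr A v p)
  onlyNbr? A v p = all? λ y → (y ∈? A) →-dec (T? (adj G v y) →-dec (y ≟ p))

  leaf? : ∀ A v → Dec (Leaf A v)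
  leaf? A v = any? (onlyNbr? A v)

  -- If all neighbours in A were p, then p would witness `Leaf`. This lets a walk that arrives from
  -- p go on without turning back.
  ¬Leaf⇒nbr≢ : ∀ {A v} → ¬ Leaf A v → ∀ p → ∃ λ y → y ∈ A × Adj G v y × y ≢ p
  ¬Leaf⇒nbr≢ {A} {v} ¬leaf p
    with any? (λ y → (y ∈? A) ×-dec (T? (adj G v y) ×-dec ¬? (y ≟ p)))
  ... | yes nbr = nbr
  ... | no none = contradiction
    (p , λ y y∈A vy → decidable-stable (y ≟ p) λ y≢p → none (y , y∈A , vy , y≢p)) ¬leaf

  -- Without a leaf a walk inside A could go on for ever and never turn back, which forces a cycle.
  leaf-exists : ¬ Cycle G → ∀ A → Nonempty A → ∃ λ v → v ∈ A × Leaf A v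
  leaf-exists acyclic A (v₀ , v₀∈A) with any? (λ v → (v ∈? A) ×-dec leaf? A v)
  ... | yes leaf   = leaf
  ... | no no-leaf = contradiction (walk⇒cycle G walk step no-return) acyclic
    where
    next : ∀ {v} → v ∈ A → ∀ p → ∃ λ y → y ∈ A × Adj G v y × y ≢ p
    next v∈A = ¬Leaf⇒nbr≢ λ leaf → no-leaf (_ , v∈A , leaf)

    -- The previous vertex is kept beside the current one, since `next` has to avoid it.
    State : Set
    State = Fin n × ∃ (_∈ A)

    state : ℕ → State
    -- There is no previous vertex at the start; `v₀` serves, as it is never its own neighbour.
    state zero    = v₀ , v₀ , v₀∈A
    state (suc i) with p , v , v∈A ← state i with y , y∈A , _ ← next v∈A p = v , y , y∈A

    walk : ℕ → Fin n
    walk i = proj₁ (proj₂ (state i))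

    step : ∀ i → Adj G (walk i) (walk (suc i))
    step i with p , v , v∈A ← state i with y , y∈A , vy , _ ← next v∈A p = vy

    no-return : ∀ i → walk i ≢ walk (suc (suc i))
    no-return i with p , v , v∈A ← state i with y , y∈A , _ ← next v∈A p
      with z , _ , _ , z≢v ← next y∈A v = ≢-sym z≢v

module _ {n} (G : Graph (Fin n)) where

  -- p is a leaf of what remains of A after removing the leaves of A.
  support-exists : ¬ Cycle G → ∀ A → Nonempty A →
    ∃ λ l → ∃ λ p → l ∈ A × OnlyNbr G A l p ×
      ∃ λ q → ∀ y → y ∈ A → Adj G p y → y ≡ q ⊎ Leaf G A y
  support-exists acyclic A (v , v∈A) = from-inner (any? inner?)
    where
    Inner : Fin n → Set
    Inner w = w ∈ A × ¬ Leaf G A w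

    inner? : Decidable Inner
    inner? w = (w ∈? A) ×-dec ¬? (leaf? G A w)

    ¬Inner⇒Leaf : ∀ {y} → y ∈ A → ¬ Inner y → Leaf G A y
    ¬Inner⇒Leaf {y} y∈A ¬inner =
      decidable-stable (leaf? G A y) λ ¬leaf → ¬inner (y∈A , ¬leaf)

    from-inner : Dec (∃ Inner) →
      ∃ λ l → ∃ λ p → l ∈ A × OnlyNbr G A l p ×
        ∃ λ q → ∀ y → y ∈ A → Adj G p y → y ≡ q ⊎ Leaf G A y
    from-inner (no none) =
      let p , only = ¬Inner⇒Leaf v∈A λ inner → none (v , inner)
      -- Every vertex of A is a leaf, so the second alternative always holds and `v` is a mere
      -- default for q.
      in v , p , v∈A , only , v , λ y y∈A _ → inj₂ (¬Inner⇒Leaf y∈A λ inner → none (y , inner))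
    from-inner (yes (w , inner))
      with leaf-exists G acyclic (subset inner?) (w , ∈-subset⁺ inner? inner)
    ... | p , p∈ , q , only-q with ∈-subset⁻ inner? p∈
    -- Not being a leaf of A, p has a neighbour l other than q; its only inner neighbour can be q,
    -- so l is a leaf.
    ...   | p∈A , ¬leaf-p with ¬Leaf⇒nbr≢ G ¬leaf-p q
    ...     | l , l∈A , pl , l≢q = l , p , l∈A , only-p , q , q-or-leaf
      where
      q-or-leaf : ∀ y → y ∈ A → Adj G p y → y ≡ q ⊎ Leaf G A y
      q-or-leaf y y∈A py with leaf? G A y
      ... | yes leaf = inj₂ leaf
      ... | no ¬leaf = inj₁ (only-q y (∈-subset⁺ inner? (y∈A , ¬leaf)) py)

      only-p : OnlyNbr G A l p
      only-p y y∈A ly with q-or-leaf l l∈A pl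
      ... | inj₁ l≡q        = contradiction l≡q l≢q
      ... | inj₂ (r , only) = trans (only y y∈A ly) (sym (only p p∈A (Adj-sym G pl)))

-- Neighbourhoods and the ends of edges

T-does⁺ : ∀ {P : Set} (P? : Dec P) → P → T (does P?)
T-does⁺ P? p = subst T (sym (dec-true P? p)) _

T-does⁻ : ∀ {P : Set} (P? : Dec P) → T (does P?) → P
T-does⁻ (yes p) _ = p

x∉p-x : ∀ {n} (p : Subset n) x → x ∉ p - x
x∉p-x (_ ∷ p) (suc x) (there x∈) = x∉p-x p x x∈

x∈p-y⇒x≢y : ∀ {n} {p : Subset n} {x y} → x ∈ p - y → x ≢ y
x∈p-y⇒x≢y {p = p} {x} x∈ refl = x∉p-x p x x∈

∈-openNbhd⁺ : ∀ {n} {G : Graph (Fin n)} {v w} → Adj G v w → w ∈ openNbhd G v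
∈-openNbhd⁺ {G = G} {v} {w} vw = ∈-subset⁺ (λ w → T? (adj G v w)) vw

∈-openNbhd⁻ : ∀ {n} {G : Graph (Fin n)} {v w} → w ∈ openNbhd G v → Adj G v w
∈-openNbhd⁻ {G = G} {v} {w} w∈ = ∈-subset⁻ (λ w → T? (adj G v w)) w∈

module _ {n} {G : Graph (Fin n)} where

  endpoint⁺ : ∀ a (e : Edge G) → a ≡ Edge.src e ⊎ a ≡ Edge.tgt e → T (endpoint a e)
  endpoint⁺ a e = Equivalence.from T-∨ ∘ Sum.map (T-does⁺ (a ≟ _)) (T-does⁺ (a ≟ _))

  endpoint⁻ : ∀ a (e : Edge G) → T (endpoint a e) → a ≡ Edge.src e ⊎ a ≡ Edge.tgt e
  endpoint⁻ a e = Sum.map (T-does⁻ (a ≟ _)) (T-does⁻ (a ≟ _)) ∘ Equivalence.to T-∨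

  Edge-≡ : ∀ {e e′ : Edge G} → Edge.src e ≡ Edge.src e′ → Edge.tgt e ≡ Edge.tgt e′ → e ≡ e′
  Edge-≡ {edge s t o a} {edge .s .t o′ a′} refl refl =
    cong₂ (edge s t) (Fin.<-irrelevant o o′) (T-irrelevant a a′)

  other-end : ∀ a (e : Edge G) → T (endpoint a e) → ∃ λ b → T (endpoint b e) × Adj G a b
  other-end a e ae with endpoint⁻ a e ae
  ... | inj₁ refl = Edge.tgt e , endpoint⁺ _ e (inj₂ refl) , Edge.adjacent e
  ... | inj₂ refl = Edge.src e , endpoint⁺ _ e (inj₁ refl) , Adj-sym G (Edge.adjacent e)

  ends-adj : ∀ a b (e : Edge G) → a ≢ b → T (endpoint a e) → T (endpoint b e) → Adj G a b
  ends-adj a b e a≢b ae be with endpoint⁻ a e ae | endpoint⁻ b e be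
  ... | inj₁ refl | inj₁ refl = contradiction refl a≢b
  ... | inj₁ refl | inj₂ refl = Edge.adjacent e
  ... | inj₂ refl | inj₁ refl = Adj-sym G (Edge.adjacent e)
  ... | inj₂ refl | inj₂ refl = contradiction refl a≢b

  -- The graph is simple, and `src < tgt` fixes the orientation: two edges that join the same
  -- vertices in opposite directions would contradict it.
  same-ends : ∀ a b (e e′ : Edge G) → a ≢ b → T (endpoint a e) → T (endpoint b e) →
    T (endpoint a e′) → T (endpoint b e′) → e ≡ e′
  same-ends a b e e′ a≢b ae be ae′ be′
    with endpoint⁻ a e ae | endpoint⁻ b e be
       | endpoint⁻ a e′ ae′ | endpoint⁻ b e′ be′
  ... | inj₁ refl | inj₁ refl | _ | _ = contradiction refl a≢b
  ... | inj₂ refl | inj₂ refl | _ | _ = contradiction refl a≢b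
  ... | _ | _ | inj₁ refl | inj₁ refl = contradiction refl a≢b
  ... | _ | _ | inj₂ refl | inj₂ refl = contradiction refl a≢b
  ... | inj₁ p | inj₂ q | inj₁ r | inj₂ s = Edge-≡ (trans (sym p) r) (trans (sym q) s)
  ... | inj₂ p | inj₁ q | inj₂ r | inj₁ s = Edge-≡ (trans (sym q) s) (trans (sym p) r)
  ... | inj₁ refl | inj₂ refl | inj₂ refl | inj₁ refl =
    contradiction (Edge.ordered e′) (Fin.<-asym (Edge.ordered e))
  ... | inj₂ refl | inj₁ refl | inj₁ refl | inj₂ refl =
    contradiction (Edge.ordered e′) (Fin.<-asym (Edge.ordered e))

-- Positions and claims

module _ {n} (p : Position n) where

  claimed≢unclaimed : ∀ {s x y} → lookup p y ≡ just s → Unclaimed p x → y ≢ x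
  claimed≢unclaimed py px refl with () ← trans (sym py) px

  claim-same : ∀ s x → lookup (claim s x p) x ≡ just s
  claim-same s x = lookup∘update x p (just s)

  claim-other : ∀ {s x y} → y ≢ x → lookup (claim s x p) y ≡ lookup p y
  claim-other {s} y≢x = lookup∘update′ y≢x p (just s)

  claim-keeps : ∀ {s t x y} → Unclaimed p x → lookup p y ≡ just t → lookup (claim s x p) y ≡ just t
  claim-keeps px py = trans (claim-other (claimed≢unclaimed py px)) py

  unclaimed? : Decidable (Unclaimed p)
  unclaimed? x with lookup p x
  ... | nothing = yes refl
  ... | just _  = no λ ()

-- Termination measure for play: each claim makes it strictly smaller.
free : ∀ {n} → Position n → Subset n
free p = subset (unclaimed? p)

free-claim : ∀ {n} (p : Position n) s {x} → Unclaimed p x → free (claim s x p) ⊂ free p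
free-claim p s {x} px = shrinks , x , ∈-subset⁺ (unclaimed? p) px , x-claimed
  where
  x-claimed : x ∉ free (claim s x p)
  x-claimed x∈ = claimed≢unclaimed (claim s x p) (claim-same p s x)
    (∈-subset⁻ (unclaimed? (claim s x p)) x∈) refl
  shrinks : free (claim s x p) ⊆ free p
  shrinks {y} y∈ with y ≟ x
  ... | yes refl = contradiction y∈ x-claimed
  ... | no y≢x   = ∈-subset⁺ (unclaimed? p)
                     (trans (sym (claim-other p y≢x)) (∈-subset⁻ (unclaimed? (claim s x p)) y∈))

-- Staller's peeling strategy

module _ {n} (G : Graph (Fin n)) (D : Subset n) where

  keeps-neighbourhood : ∀ p {s x} → Unclaimed p x →
    StallerClaimsNeighbourhood G D p → StallerClaimsNeighbourhood G D (claim s x p)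
  keeps-neighbourhood p px (v , v∉D , claimed) = v , v∉D , λ w w∈ → claim-keeps p px (claimed w w∈)

  -- A win is only recorded on a full board, so the remaining moves must be played out; claims are
  -- never revoked, hence any moves will do.
  claimed⇒wins : ∀ p s → Acc _⊂_ (free p) → StallerClaimsNeighbourhood G D p → StallerWinsFrom G D s p
  claimed⇒wins p s (acc rs) won with any? (unclaimed? p)
  ... | no full = game-over (λ x px → full (x , px)) won
  claimed⇒wins p staller (acc rs) won | yes (x , px) =
    staller-moves x px (claimed⇒wins _ dominator (rs (free-claim p staller px))
      (keeps-neighbourhood p px won))
  claimed⇒wins p dominator (acc rs) won | yes any =
    dominator-moves any λ x px →
      claimed⇒wins _ staller (rs (free-claim p dominator px)) (keeps-neighbourhood p px won)

  -- Taking v itself completes its closed neighbourhood. Staller finishes this way when a leaf has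
  -- no unclaimed neighbour left or when Dominator ignores a threat.
  completes : ∀ {p v} → v ∉ D → Unclaimed p v →
    (∀ w → Adj G v w → lookup p w ≡ just staller) → StallerWinsFrom G D staller p
  completes {p} {v} v∉D pv claimed =
    staller-moves v pv (claimed⇒wins _ dominator (⊂-wellFounded _) (v , v∉D , all-claimed))
    where
    all-claimed : ∀ w → w ∈ closedNbhd G v → lookup (claim staller v p) w ≡ just staller
    all-claimed w w∈ with x∈p∪q⁻ ⁅ v ⁆ (openNbhd G v) w∈
    ... | inj₁ w∈⁅v⁆ rewrite x∈⁅y⁆⇒x≡y v w∈⁅v⁆ = claim-same p staller v
    ... | inj₂ w∈N   = claim-keeps p pv (claimed w (∈-openNbhd⁻ {G = G} w∈N))

  module _ {k} (H : Graph (Fin k)) (acyclic : ¬ Cycle H)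
           (f : Fin k → Fin n) (g : Edge H → Fin n)
           (f-injective : ∀ {a b} → f a ≡ f b → a ≡ b)
           (f≢g : ∀ {a e} → f a ≢ g e)
           (f∉D : ∀ a → f a ∉ D)
           (closed : ∀ a w → Adj G (f a) w → ∃ λ e → T (endpoint a e) × g e ≡ w) where

    -- A is the part of the tree H that has not been peeled off yet.
    record Live (A : Subset k) (p : Position n) : Set where
      field
        vertex-free : ∀ {a} → a ∈ A → Unclaimed p (f a)
        edge-live   : ∀ {a e} → a ∈ A → T (endpoint a e) →
          lookup p (g e) ≡ just staller ⊎ (Unclaimed p (g e) × ∀ b → T (endpoint b e) → b ∈ A)
    open Live

    -- Induction on A. Peeling off a leaf leaves its connecting edge with Staller, so an edge
    -- leading out of A is hers and an unclaimed one joins two vertices of A; `Live` records this.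
    peeling : ∀ {A p} → Acc _⊂_ A → Nonempty A → Live A p → StallerWinsFrom G D staller p
    peeling {A} {p} (acc rs) A≢∅ live with leaf-exists H acyclic A A≢∅
    ... | x , x∈A , y , only-y with any? (λ w → T? (adj G (f x) w) ×-dec unclaimed? p w)
    -- Every edge at x is already Staller's, as happens when x alone is left, so taking `f x` wins.
    ... | no none = completes (f∉D x) (vertex-free live x∈A) claimed
      where
      claimed : ∀ w → Adj G (f x) w → lookup p w ≡ just staller
      claimed w xw with closed x w xw
      ... | e , xe , refl with edge-live live {e = e} x∈A xe
      ...   | inj₁ pw       = pw
      ...   | inj₂ (pw , _) = contradiction (w , xw , pw) none
    ... | yes (w , xw , pw) with closed x w xw
    ... | e , xe , refl with edge-live live {e = e} x∈A xe
    ... | inj₁ pw′ = contradiction refl (claimed≢unclaimed p pw′ pw)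
    ... | inj₂ (_ , ends∈A) with other-end x e xe
    -- The claim of w leaves `f x` as the last vertex missing from its neighbourhood, so Dominator
    -- has to take it.
    ... | z , ze , xz = staller-moves w pw (dominator-moves (f x , x-free) answer)
      where
      p₁ = claim staller w p

      x-free : Unclaimed p₁ (f x)
      x-free = trans (claim-other p f≢g) (vertex-free live x∈A)

      z≡y : z ≡ y
      z≡y = only-y z (ends∈A z ze) xz

      -- In A the leaf x has the single neighbour y, so an edge from x to another vertex of A has
      -- the same ends as e.
      edge-unique : ∀ {a e′} → a ∈ A → a ≢ x → T (endpoint x e′) → T (endpoint a e′) → e′ ≡ e
      edge-unique {a} {e′} a∈A a≢x xe′ ae′ = same-ends x a e′ e (≢-sym a≢x) xe′ ae′ xe
        (subst (λ c → T (endpoint c e)) (trans z≡y (sym a≡y)) ze)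
        where
        a≡y : a ≡ y
        a≡y = only-y a a∈A (ends-adj x a e′ (≢-sym a≢x) xe′ ae′)

      live-edge≡e : ∀ {e′} → T (endpoint x e′) → (∀ b → T (endpoint b e′) → b ∈ A) → e′ ≡ e
      live-edge≡e {e′} xe′ ends with other-end x e′ xe′
      ... | b , be′ , xb = edge-unique (ends b be′) (≢-sym (Adj⇒≢ H xb)) xe′ be′

      answer : ∀ d → Unclaimed p₁ d → StallerWinsFrom G D staller (claim dominator d p₁)
      answer d p₁d with d ≟ f x
      ... | no d≢fx = completes (f∉D x) (trans (claim-other p₁ (≢-sym d≢fx)) x-free) claimed
        where
        claimed : ∀ v → Adj G (f x) v → lookup (claim dominator d p₁) v ≡ just staller
        claimed v xv with closed x v xv
        ... | e′ , xe′ , refl with edge-live live {e = e′} x∈A xe′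
        ...   | inj₁ pv = claim-keeps p₁ p₁d (claim-keeps p pw pv)
        -- The only edge at x with both ends in A is e, whose vertex w has just been claimed.
        ...   | inj₂ (_ , ends) rewrite live-edge≡e {e′} xe′ ends =
          claim-keeps p₁ p₁d (claim-same p staller w)
      ... | yes refl = peeling (rs (x∈p⇒p-x⊂p x∈A))
                         (z , x∈p∧x≢y⇒x∈p-y (ends∈A z ze) (≢-sym (Adj⇒≢ H xz)))
                         record { vertex-free = free′ ; edge-live = live′ }
        where
        p₂ = claim dominator (f x) p₁

        free′ : ∀ {a} → a ∈ A - x → Unclaimed p₂ (f a)
        free′ a∈ = trans (claim-other p₁ (x∈p-y⇒x≢y a∈ ∘ f-injective))
                  (trans (claim-other p f≢g) (vertex-free live (p─q⊆p _ _ a∈)))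

        live′ : ∀ {a e′} → a ∈ A - x → T (endpoint a e′) →
          lookup p₂ (g e′) ≡ just staller ⊎ (Unclaimed p₂ (g e′) × ∀ b → T (endpoint b e′) → b ∈ A - x)
        live′ {a} {e′} a∈ ae′ with g e′ ≟ w
        ... | yes eq rewrite eq = inj₁ (claim-keeps p₁ p₁d (claim-same p staller w))
        ... | no e′≢w with edge-live live {e = e′} (p─q⊆p _ _ a∈) ae′
        ...   | inj₁ pe′ = inj₁ (claim-keeps p₁ p₁d (claim-keeps p pw pe′))
        ...   | inj₂ (pe′ , ends) = inj₂
          ( trans (claim-other p₁ (≢-sym f≢g)) (trans (claim-other p e′≢w) pe′)
          -- If x were an end of e′, then e′ would be e, and `g e′` would be w.
          , λ b be′ → x∈p∧x≢y⇒x∈p-y (ends b be′) λ where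
              refl → e′≢w (cong g (edge-unique (p─q⊆p _ _ a∈) (x∈p-y⇒x≢y a∈) be′ ae′)))

    peeling-wins : Fin k → StallerWins G D
    peeling-wins a = peeling (⊂-wellFounded ⊤) (a , ∈⊤) record
      { vertex-free = λ _ → lookup-replicate {n = n} _ nothing
      ; edge-live   = λ _ _ → inj₂ (lookup-replicate {n = n} _ nothing , λ _ _ → ∈⊤)
      }

-- Dominator's pairing strategy

-- Unmatched vertices are the fixed points of `mate`.
record Matching {n} (G : Graph (Fin n)) (A D : Subset n) : Set where
  field
    mate       : Fin n → Fin n
    involutive : ∀ v → mate (mate v) ≡ v
    mate-adj   : ∀ {v} → mate v ≢ v → Adj G v (mate v)
    support    : ∀ {v} → mate v ≢ v → v ∈ A
    covers     : ∀ {v} → v ∈ A → v ∉ D → mate v ≢ v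

module _ {n} {G : Graph (Fin n)} {D : Subset n} (M : Matching G ⊤ D) where
  open Matching M

  Guarded : Position n → Set
  Guarded p = ∀ v → mate v ≢ v → lookup p v ≡ just staller → lookup p (mate v) ≡ just dominator

  -- A vertex outside D is matched, and its mate lies in its closed neighbourhood; Staller cannot
  -- own both.
  guarded⇒safe : ∀ p → Guarded p → ¬ StallerClaimsNeighbourhood G D p
  guarded⇒safe _ guarded (v , v∉D , claimed) =
    case trans (sym mate-dominator) mate-staller of λ ()
    where
    matched        = covers ∈⊤ v∉D
    mate-dominator = guarded v matched (claimed v (p⊆p∪q _ (x∈⁅x⁆ v)))
    mate-staller   = claimed (mate v) (q⊆p∪q _ _ (∈-openNbhd⁺ {G = G} (mate-adj matched)))

  dominator-keeps : ∀ p {y} → Guarded p → Unclaimed p y → Guarded (claim dominator y p)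
  dominator-keeps p {y} guarded py v matched p′v with v ≟ y
  ... | yes refl with () ← trans (sym (claim-same p dominator v)) p′v
  ... | no v≢y = claim-keeps p py (guarded v matched (trans (sym (claim-other p v≢y)) p′v))

  -- Dominator replies with the mate of x. If x is unmatched or its mate is already his, the
  -- invariant survives without a reply. The mate cannot be Staller's, since its guard would be x,
  -- which was still unclaimed.
  after-staller : ∀ p {x} → Guarded p → Unclaimed p x → let p′ = claim staller x p in
    Guarded p′ ⊎ (Unclaimed p′ (mate x) × Guarded (claim dominator (mate x) p′))
  after-staller p {x} guarded px = go (mate x ≟ x)
    where
    p′ = claim staller x p

    guarded-off-x : ∀ {v} → v ≢ x → mate v ≢ v → lookup p′ v ≡ just staller →
      lookup p′ (mate v) ≡ just dominator
    guarded-off-x v≢x matched p′v =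
      claim-keeps p px (guarded _ matched (trans (sym (claim-other p v≢x)) p′v))

    go : Dec (mate x ≡ x) → Guarded p′ ⊎ (Unclaimed p′ (mate x) × Guarded (claim dominator (mate x) p′))
    go (yes fixed) = inj₁ λ v matched → guarded-off-x (λ { refl → matched fixed }) matched
    go (no matched) with lookup p (mate x) in eq
    ... | just staller = contradiction
      (subst (λ v → lookup p v ≡ just dominator) (involutive x)
        (guarded (mate x) (λ e → matched (trans (sym e) (involutive x))) eq))
      λ px′ → claimed≢unclaimed p px′ px refl
    ... | just dominator = inj₁ λ v m p′v → case v ≟ x of λ where
      (yes refl) → claim-keeps p px eq
      (no v≢x)   → guarded-off-x v≢x m p′v
    ... | nothing = inj₂ (p′mx , λ v m p″v → case v ≟ x of λ where
        (yes refl) → claim-same p′ dominator (mate x)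
        (no v≢x)   → case v ≟ mate x of λ where
          (yes refl) → case trans (sym (claim-same p′ dominator v)) p″v of λ ()
          (no v≢mx)  → claim-keeps p′ p′mx (guarded-off-x v≢x m (trans (sym (claim-other p′ v≢mx)) p″v)))
      where
      p′mx : Unclaimed p′ (mate x)
      p′mx = trans (claim-other p matched) eq

  pairing : ∀ p → Guarded p → ¬ StallerWinsFrom G D staller p
  pairing p guarded (game-over _ won) = guarded⇒safe p guarded won
  pairing p guarded (staller-moves x px wins) with after-staller p guarded px | wins
  ... | inj₁ guarded′ | game-over _ won = guarded⇒safe (claim staller x p) guarded′ won
  ... | inj₂ (free , _) | game-over full _ = full _ free
  -- No particular reply is required, so Dominator takes the vertex whose existence the constructor
  -- provides.
  ... | inj₁ guarded′ | dominator-moves (y , py) wins′ =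
    pairing _ (dominator-keeps (claim staller x p) guarded′ py) (wins′ y py)
  ... | inj₂ (free , guarded″) | dominator-moves _ wins′ = pairing _ guarded″ (wins′ _ free)

  pairing-wins : ¬ StallerWins G D
  pairing-wins = pairing (replicate n nothing) λ v _ pv →
    case trans (sym (lookup-replicate v nothing)) pv of λ ()

-- Obstructions and matchings relative to a vertex set

-- A subdivided tree in G, closed in A and avoiding D: f enumerates its original vertices with the
-- root last, and g i subdivides the edge from `inject₁ i` to its parent.
record Obstruction {n} (G : Graph (Fin n)) (A D : Subset n) : Set where
  field
    k           : ℕ
    parent      : Fin k → Fin (suc k)
    parent-<    : ∀ i → inject₁ i < parent i
    f           : Fin (suc k) → Fin n
    g           : Fin k → Fin n
    f-injective : ∀ {a b} → f a ≡ f b → a ≡ b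
    g-injective : ∀ {i j} → g i ≡ g j → i ≡ j
    f≢g         : ∀ {a i} → f a ≢ g i
    f∈A         : ∀ a → f a ∈ A
    g∈A         : ∀ i → g i ∈ A
    f∉D         : ∀ a → f a ∉ D
    child-adj   : ∀ i → Adj G (f (inject₁ i)) (g i)
    parent-adj  : ∀ i → Adj G (f (parent i)) (g i)
    closed      : ∀ a w → w ∈ A → Adj G (f a) w → ∃ λ i → g i ≡ w × (a ≡ inject₁ i ⊎ a ≡ parent i)

module _ {n} {G : Graph (Fin n)} where

  -- In a larger A only `closed` could fail; `no-new` prevents this by keeping the added vertices
  -- away from the original ones.
  enlarge : ∀ {A A′ D D′} (O : Obstruction G A′ D′) → A′ ⊆ A → D ⊆ D′ →
    (∀ a w → w ∈ A → Adj G (Obstruction.f O a) w → w ∈ A′) → Obstruction G A D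
  enlarge O A′⊆A D⊆D′ no-new = record
    { k           = k
    ; parent      = parent
    ; parent-<    = parent-<
    ; f           = f
    ; g           = g
    ; f-injective = f-injective
    ; g-injective = g-injective
    ; f≢g         = f≢g
    ; f∈A         = A′⊆A ∘ f∈A
    ; g∈A         = A′⊆A ∘ g∈A
    ; f∉D         = λ a → f∉D a ∘ D⊆D′
    ; child-adj   = child-adj
    ; parent-adj  = parent-adj
    ; closed      = λ a w w∈A aw → closed a w (no-new a w w∈A aw) aw
    }
    where open Obstruction O

  -- The subdivision of the one-vertex tree, from which obstructions grow.
  isolated : ∀ {A D l} → l ∈ A → l ∉ D → (∀ w → w ∈ A → ¬ Adj G l w) → Obstruction G A D
  isolated {l = l} l∈A l∉D no-nbr = record
    { k           = 0
    ; parent      = λ ()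
    ; parent-<    = λ ()
    ; f           = λ _ → l
    ; g           = λ ()
    ; f-injective = λ { {zero} {zero} _ → refl }
    ; g-injective = λ { {()} }
    ; f≢g         = λ { {i = ()} }
    ; f∈A         = λ _ → l∈A
    ; g∈A         = λ ()
    ; f∉D         = λ _ → l∉D
    ; child-adj   = λ ()
    ; parent-adj  = λ ()
    ; closed      = λ _ w w∈A lw → contradiction lw (no-nbr w w∈A)
    }

  module _ {A D l p} (l∈A : l ∈ A) (p∈A : p ∈ A) (l∉D : l ∉ D)
           (lp : Adj G l p) (only-p : OnlyNbr G A l p)
           (O : Obstruction G (A - l - p) D) where
    open Obstruction O

    -- The leaf l is hung below `a₀`, with p subdividing the new edge. It takes index 0, so the old
    -- indices shift by one and parents stay larger than children. By `only-a₀`, p meets no third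
    -- original vertex, which would violate `closed`.
    grow : (a₀ : Fin (suc k)) → Adj G (f a₀) p → (∀ a → Adj G (f a) p → a ≡ a₀) → Obstruction G A D
    grow a₀ a₀p only-a₀ = record
      { k           = suc k
      ; parent      = parent′
      ; parent-<    = λ { zero → z<s ; (suc i) → s<s (parent-< i) }
      ; f           = f′
      ; g           = g′
      ; f-injective = f′-injective
      ; g-injective = g′-injective
      ; f≢g         = λ {a} {i} → f′≢g′ a i
      ; f∈A         = λ { zero → l∈A ; (suc a) → ∈A′⇒∈A (f∈A a) }
      ; g∈A         = λ { zero → p∈A ; (suc i) → ∈A′⇒∈A (g∈A i) }
      ; f∉D         = λ { zero → l∉D ; (suc a) → f∉D a }
      ; child-adj   = λ { zero → lp ; (suc i) → child-adj i }
      ; parent-adj  = λ { zero → a₀p ; (suc i) → parent-adj i }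
      ; closed      = closed′
      }
      where
      ∈A′⇒∈A : ∀ {v} → v ∈ A - l - p → v ∈ A
      ∈A′⇒∈A = p─q⊆p _ _ ∘ p─q⊆p _ _

      ≢l : ∀ {v} → v ∈ A - l - p → v ≢ l
      ≢l = x∈p-y⇒x≢y ∘ p─q⊆p _ _

      ≢p : ∀ {v} → v ∈ A - l - p → v ≢ p
      ≢p = x∈p-y⇒x≢y

      parent′ : Fin (suc k) → Fin (suc (suc k))
      parent′ zero    = suc a₀
      parent′ (suc i) = suc (parent i)

      f′ : Fin (suc (suc k)) → Fin n
      f′ zero    = l
      f′ (suc a) = f a

      g′ : Fin (suc k) → Fin n
      g′ zero    = p
      g′ (suc i) = g i

      f′-injective : ∀ {a b} → f′ a ≡ f′ b → a ≡ b
      f′-injective {zero}  {zero}  eq = refl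
      f′-injective {zero}  {suc b} eq = contradiction (sym eq) (≢l (f∈A b))
      f′-injective {suc a} {zero}  eq = contradiction eq (≢l (f∈A a))
      f′-injective {suc a} {suc b} eq = cong suc (f-injective eq)

      g′-injective : ∀ {i j} → g′ i ≡ g′ j → i ≡ j
      g′-injective {zero}  {zero}  eq = refl
      g′-injective {zero}  {suc j} eq = contradiction (sym eq) (≢p (g∈A j))
      g′-injective {suc i} {zero}  eq = contradiction eq (≢p (g∈A i))
      g′-injective {suc i} {suc j} eq = cong suc (g-injective eq)

      f′≢g′ : ∀ a i → f′ a ≢ g′ i
      f′≢g′ zero    zero    = Adj⇒≢ G lp
      f′≢g′ zero    (suc i) = ≢-sym (≢l (g∈A i))
      f′≢g′ (suc a) zero    = ≢p (f∈A a)
      f′≢g′ (suc a) (suc i) = f≢g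

      closed′ : ∀ a w → w ∈ A → Adj G (f′ a) w → ∃ λ i → g′ i ≡ w × (a ≡ inject₁ i ⊎ a ≡ parent′ i)
      closed′ zero w w∈A lw = zero , sym (only-p w w∈A lw) , inj₁ refl
      closed′ (suc a) w w∈A aw with w ≟ p
      ... | yes refl = zero , refl , inj₂ (cong suc (only-a₀ a aw))
      ... | no w≢p with w ≟ l
      -- An old original vertex adjacent to l would have to be p, which has been removed.
      ...   | yes refl = contradiction (only-p (f a) (∈A′⇒∈A (f∈A a)) (Adj-sym G aw)) (≢p (f∈A a))
      ...   | no w≢l with closed a w (x∈p∧x≢y⇒x∈p-y (x∈p∧x≢y⇒x∈p-y w∈A w≢l) w≢p) aw
      ...     | i , gi≡w , end = suc i , gi≡w , Sum.map (cong suc) (cong suc) end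

  module _ {A A′ D D′ : Subset n} (M : Matching G A′ D′) where
    open Matching M

    unsupported : ∀ {v} → v ∉ A′ → mate v ≡ v
    unsupported {v} v∉A′ = decidable-stable (mate v ≟ v) (v∉A′ ∘ support)

    relax : A′ ⊆ A → (∀ {v} → v ∈ A → v ∉ D → mate v ≢ v) → Matching G A D
    relax A′⊆A covers′ = record
      { mate       = mate
      ; involutive = involutive
      ; mate-adj   = mate-adj
      ; support    = A′⊆A ∘ support
      ; covers     = covers′
      }

    add-pair : ∀ {l p} → Adj G l p → l ∈ A → p ∈ A → mate l ≡ l → mate p ≡ p → A′ ⊆ A →
      (∀ {v} → v ∈ A → v ∉ D → v ≢ l → v ≢ p → mate v ≢ v) → Matching G A D
    add-pair {l} {p} lp l∈A p∈A ml mp A′⊆A covers′ = record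
      { mate       = mate′
      ; involutive = involutive′
      ; mate-adj   = adj′
      ; support    = support′
      ; covers     = covers″
      }
      where
      l≢p = Adj⇒≢ G lp

      mate′ : Fin n → Fin n
      mate′ v with v ≟ l | v ≟ p
      ... | yes _ | _     = p
      ... | no _  | yes _ = l
      ... | no _  | no _  = mate v

      mate′-l : mate′ l ≡ p
      mate′-l with l ≟ l
      ... | yes _  = refl
      ... | no l≢l = contradiction refl l≢l

      mate′-p : mate′ p ≡ l
      mate′-p with p ≟ l | p ≟ p
      ... | yes p≡l | _      = contradiction (sym p≡l) l≢p
      ... | no _    | yes _  = refl
      ... | no _    | no p≢p = contradiction refl p≢p

      mate′-other : ∀ {v} → v ≢ l → v ≢ p → mate′ v ≡ mate v
      mate′-other {v} v≢l v≢p with v ≟ l | v ≟ p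
      ... | yes v≡l | _       = contradiction v≡l v≢l
      ... | no _    | yes v≡p = contradiction v≡p v≢p
      ... | no _    | no _    = refl

      -- An involution maps nothing else to a fixed point; hence no other vertex has l or p as its
      -- old mate, and `mate′` is again an involution.
      mate-fixed : ∀ {u v} → mate u ≡ u → mate v ≡ u → v ≡ u
      mate-fixed mu mv≡u = trans (sym (involutive _)) (trans (cong mate mv≡u) mu)

      involutive′ : ∀ v → mate′ (mate′ v) ≡ v
      involutive′ v = go (v ≟ l) (v ≟ p)
        where
        go : Dec (v ≡ l) → Dec (v ≡ p) → mate′ (mate′ v) ≡ v
        go (yes refl) _          = trans (cong mate′ mate′-l) mate′-p
        go (no _)     (yes refl) = trans (cong mate′ mate′-p) mate′-l
        go (no v≢l)   (no v≢p)   = trans (cong mate′ (mate′-other v≢l v≢p))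
          (trans (mate′-other (v≢l ∘ mate-fixed ml) (v≢p ∘ mate-fixed mp)) (involutive v))

      adj′ : ∀ {v} → mate′ v ≢ v → Adj G v (mate′ v)
      adj′ {v} moved with v ≟ l | v ≟ p
      ... | yes refl | _        = lp
      ... | no _     | yes refl = Adj-sym G lp
      ... | no _     | no _     = mate-adj moved

      support′ : ∀ {v} → mate′ v ≢ v → v ∈ A
      support′ {v} moved with v ≟ l | v ≟ p
      ... | yes refl | _        = l∈A
      ... | no _     | yes refl = p∈A
      ... | no _     | no _     = A′⊆A (support moved)

      covers″ : ∀ {v} → v ∈ A → v ∉ D → mate′ v ≢ v
      covers″ {v} v∈A v∉D with v ≟ l | v ≟ p
      ... | yes refl | _        = ≢-sym l≢p
      ... | no _     | yes refl = l≢p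
      ... | no v≢l   | no v≢p   = covers′ v∈A v∉D v≢l v≢p

-- The dichotomy between matchings and obstructions

module _ {n} (G : Graph (Fin n)) (acyclic : ¬ Cycle G) where

  -- Working relative to A and D keeps the graph fixed while the induction deletes vertices from A
  -- and enlarges D.
  matching-or-obstruction : ∀ A D → Acc _⊂_ A → Matching G A D ⊎ Obstruction G A D
  matching-or-obstruction A D (acc rs) with nonempty? A
  ... | no A≡∅ = inj₁ record
    { mate       = id
    ; involutive = λ _ → refl
    ; mate-adj   = contradiction refl
    ; support    = contradiction refl
    ; covers     = λ v∈A → contradiction (_ , v∈A) A≡∅
    }
  ... | yes A≢∅ with support-exists G acyclic A A≢∅
  -- `OnlyNbr` leaves p arbitrary when l is isolated in A, so whether p is a neighbour has to be
  -- decided.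
  ... | l , p , l∈A , only-p , q , q-or-leaf = go (l ∈? D) ((p ∈? A) ×-dec T? (adj G l p))
    where
    A-l⊂A : A - l ⊂ A
    A-l⊂A = x∈p⇒p-x⊂p l∈A

    go : Dec (l ∈ D) → Dec (p ∈ A × Adj G l p) → Matching G A D ⊎ Obstruction G A D
    go (no l∉D) (no no-nbr) =
      inj₂ (isolated l∈A l∉D λ w w∈A lw → no-nbr
        (subst (λ v → v ∈ A × Adj G l v) (only-p w w∈A lw) (w∈A , lw)))
    go (yes l∈D) (no no-nbr) = Sum.map
      (λ M → relax M (p─q⊆p _ _) λ v∈A v∉D →
        Matching.covers M (x∈p∧x≢y⇒x∈p-y v∈A λ { refl → v∉D l∈D }) v∉D)
      (λ O → enlarge O (p─q⊆p _ _) id λ a w w∈A aw → x∈p∧x≢y⇒x∈p-y w∈A λ { refl →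
        let fa∈A = p─q⊆p _ _ (Obstruction.f∈A O a) in
        no-nbr (subst (λ v → v ∈ A × Adj G l v) (only-p _ fa∈A (Adj-sym G aw))
                      (fa∈A , Adj-sym G aw)) })
      (matching-or-obstruction (A - l) D (rs A-l⊂A))
    -- No original vertex of an obstruction in A can be p, as its neighbour l would then have to
    -- be adjacent to a second original vertex; so p may be put into D.
    go (yes l∈D) (yes (p∈A , lp)) = Sum.map lift-matching
      (λ O → enlarge O (p─q⊆p _ _) (p⊆p∪q _) λ a w w∈A aw → x∈p∧x≢y⇒x∈p-y w∈A λ { refl →
        Obstruction.f∉D O a (q⊆p∪q _ _ (subst (_∈ ⁅ p ⁆)
          (sym (only-p _ (p─q⊆p _ _ (Obstruction.f∈A O a)) (Adj-sym G aw))) (x∈⁅x⁆ p))) })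
      (matching-or-obstruction (A - l) (D ∪ ⁅ p ⁆) (rs A-l⊂A))
      where
      lift-matching : Matching G (A - l) (D ∪ ⁅ p ⁆) → Matching G A D
      lift-matching M with Matching.mate M p ≟ p
      -- M may leave p unmatched, since p was put into the exempt set; the equally unmatched l then
      -- becomes its mate.
      ... | yes mp = add-pair M lp l∈A p∈A (unsupported {A = A} {D = D} M (x∉p-x A l)) mp (p─q⊆p _ _)
        λ v∈A v∉D v≢l v≢p → Matching.covers M (x∈p∧x≢y⇒x∈p-y v∈A v≢l)
          λ v∈ → [ v∉D , v≢p ∘ x∈⁅y⁆⇒x≡y p ]′ (x∈p∪q⁻ D ⁅ p ⁆ v∈)
      ... | no mp≢p = relax M (p─q⊆p _ _) covers′
        where
        covers′ : ∀ {v} → v ∈ A → v ∉ D → Matching.mate M v ≢ v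
        covers′ {v} v∈A v∉D with v ≟ p
        ... | yes refl = mp≢p
        ... | no v≢p = Matching.covers M (x∈p∧x≢y⇒x∈p-y v∈A λ { refl → v∉D l∈D })
          λ v∈ → [ v∉D , v≢p ∘ x∈⁅y⁆⇒x≡y p ]′ (x∈p∪q⁻ D ⁅ p ⁆ v∈)
    go (no l∉D) (yes (p∈A , lp))
      -- A second leaf l′ outside D competes with l for p, and the path l, p, l′ is the subdivision
      -- of a single edge.
      with any? (λ l′ → (l′ ∈? A) ×-dec ¬? (l′ ≟ l) ×-dec ¬? (l′ ∈? D) ×-dec
                        T? (adj G p l′) ×-dec leaf? G A l′)
    ... | yes (l′ , l′∈A , l′≢l , l′∉D , pl′ , r , only-r) =
      inj₂ (grow l∈A p∈A l∉D lp only-p single zero (Adj-sym G pl′) λ { zero _ → refl })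
      where
      single : Obstruction G (A - l - p) D
      single = isolated (x∈p∧x≢y⇒x∈p-y (x∈p∧x≢y⇒x∈p-y l′∈A l′≢l) (≢-sym (Adj⇒≢ G pl′))) l′∉D
        λ w w∈ l′w → x∈p-y⇒x≢y w∈
          (trans (only-r w (p─q⊆p _ _ (p─q⊆p _ _ w∈)) l′w) (sym (only-r p p∈A (Adj-sym G pl′))))
    ... | no no-second = Sum.map
      (λ M → add-pair M lp l∈A p∈A
        (unsupported {A = A} {D = D} M (x∉p-x A l ∘ p─q⊆p _ _))
        (unsupported {A = A} {D = D} M (x∉p-x (A - l) p))
        (p─q⊆p _ _ ∘ p─q⊆p _ _)
        λ v∈A v∉D v≢l v≢p → Matching.covers M (x∈p∧x≢y⇒x∈p-y (x∈p∧x≢y⇒x∈p-y v∈A v≢l) v≢p) v∉D)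
      lift-obstruction
      (matching-or-obstruction (A - l - p) D (rs (⊆-⊂-trans (p─q⊆p _ _) A-l⊂A)))
      where
      lift-obstruction : Obstruction G (A - l - p) D → Obstruction G A D
      lift-obstruction O with any? (λ a → T? (adj G (Obstruction.f O a) p))
      ... | yes (a₀ , a₀p) = grow l∈A p∈A l∉D lp only-p O a₀ a₀p λ a ap →
        f-injective (trans (≡q a ap) (sym (≡q a₀ a₀p)))
        where
        open Obstruction O
        -- An original vertex adjacent to p other than q would be a second leaf outside D; so `a₀`
        -- is the only one.
        ≡q : ∀ a → Adj G (f a) p → f a ≡ q
        ≡q a ap with q-or-leaf (f a) (p─q⊆p _ _ (p─q⊆p _ _ (f∈A a))) (Adj-sym G ap)
        ... | inj₁ eq   = eq
        ... | inj₂ leaf = contradiction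
          ( f a , p─q⊆p _ _ (p─q⊆p _ _ (f∈A a)) , x∈p-y⇒x≢y (p─q⊆p _ _ (f∈A a))
          , f∉D a , Adj-sym G ap , leaf ) no-second
      -- Neither p nor l, whose only neighbour is p, is adjacent to an original vertex.
      ... | no untouched = enlarge O (p─q⊆p _ _ ∘ p─q⊆p _ _) id λ a w w∈A aw →
        x∈p∧x≢y⇒x∈p-y
          (x∈p∧x≢y⇒x∈p-y w∈A λ { refl → x∈p-y⇒x≢y (f∈A a)
            (only-p (f a) (p─q⊆p _ _ (p─q⊆p _ _ (f∈A a))) (Adj-sym G aw)) })
          λ { refl → untouched (a , aw) }
        where open Obstruction O

-- Symmetric graphs, cardinalities and cycle neighbours

T-ext : ∀ {x y} → (T x → T y) → (T y → T x) → x ≡ y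
T-ext to from = does-⇔ (mk⇔ to from) (T? _) (T? _)

∃∈-≡ : ∀ {n} {p : Subset n} {x y : ∃ (_∈ p)} → proj₁ x ≡ proj₁ y → x ≡ y
∃∈-≡ {x = v , v∈p} {.v , v∈p′} refl = cong (v ,_) ([]=-irrelevant v∈p v∈p′)

-- Used to turn equal degrees into equal neighbourhoods: a missing element would make the inclusion,
-- and so the inequality of sizes, strict.
⊆∧∣∣≡⇒⊇ : ∀ {n} {p q : Subset n} → p ⊆ q → ∣ q ∣ ≡ ∣ p ∣ → q ⊆ p
⊆∧∣∣≡⇒⊇ {p = p} p⊆q eq {x} x∈q = decidable-stable (x ∈? p) λ x∉p →
  ℕ.<-irrefl (sym eq) (p⊂q⇒∣p∣<∣q∣ (p⊆q , x , x∈q , x∉p))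

module _ {n} {R : Fin n → Fin n → Set} (R? : ∀ u v → Dec (R u v)) (irrefl : ∀ v → ¬ R v v) where

  symGraph : Graph (Fin n)
  symGraph = record
    { adj        = λ u v → does (R? u v ⊎-dec R? v u)
    ; adj-sym    = λ u v → does-⇔ (mk⇔ Sum.swap Sum.swap) (R? u v ⊎-dec R? v u) (R? v u ⊎-dec R? u v)
    ; adj-irrefl = λ v → dec-false (R? v v ⊎-dec R? v v) [ irrefl v , irrefl v ]′
    }

  symGraph⁺ : ∀ {u v} → R u v ⊎ R v u → Adj symGraph u v
  symGraph⁺ {u} {v} = T-does⁺ (R? u v ⊎-dec R? v u)

  symGraph⁻ : ∀ {u v} → Adj symGraph u v → R u v ⊎ R v u
  symGraph⁻ {u} {v} = T-does⁻ (R? u v ⊎-dec R? v u)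

module _ {V : Set} {G : Graph V} (C : Cycle G) where
  open Cycle C

  -- These are the predecessor and the successor on the cycle, with wrap-around at both ends; they
  -- differ because a cycle has at least three vertices.
  cycle-nbrs : ∀ j → ∃₂ λ x y → x ≢ y × Adj G (vertex j) (vertex x) × Adj G (vertex j) (vertex y)
  cycle-nbrs zero = suc zero , fromℕ _ , (λ ()) , step zero , Adj-sym G close
  cycle-nbrs (suc i) with view i
  ... | ‵fromℕ = zero , inject₁ (fromℕ _) , (λ ()) , close , Adj-sym G (step (fromℕ _))
  ... | ‵inject₁ i′ = inject₁ (inject₁ i′) , suc (suc i′) , distinct
                    , Adj-sym G (step (inject₁ i′)) , step (suc i′)
    where
    distinct : inject₁ (inject₁ i′) ≢ suc (suc i′)
    distinct eq = ℕ.<-irrefl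
      (trans (sym (trans (Fin.toℕ-inject₁ (inject₁ i′)) (Fin.toℕ-inject₁ i′))) (cong toℕ eq))
      (ℕ.m≤n⇒m≤1+n ℕ.≤-refl)

-- Trees given by parent functions

module ParentTree {k} (parent : Fin k → Fin (suc k)) (parent-< : ∀ i → inject₁ i < parent i) where

  ChildOf : Fin (suc k) → Fin (suc k) → Set
  ChildOf a b = ∃ λ i → inject₁ i ≡ a × parent i ≡ b

  childOf? : ∀ a b → Dec (ChildOf a b)
  childOf? a b = any? λ i → (inject₁ i ≟ a) ×-dec (parent i ≟ b)

  childOf⇒< : ∀ {a b} → ChildOf a b → a < b
  childOf⇒< (i , refl , refl) = parent-< i

  childOf-irrefl : ∀ a → ¬ ChildOf a a
  childOf-irrefl a c = Fin.<-irrefl refl (childOf⇒< c)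

  tree : Graph (Fin (suc k))
  tree = symGraph childOf? childOf-irrefl

  to-root : ∀ a → Acc _>_ a → Star (Adj tree) a (fromℕ k)
  to-root a (acc rs) with view a
  ... | ‵fromℕ     = ε
  ... | ‵inject₁ i = symGraph⁺ childOf? childOf-irrefl (inj₁ (i , refl , refl))
                     ◅ to-root (parent i) (rs (parent-< i))

  -- On a cycle every vertex would have a child on the cycle, as only one of its two neighbours
  -- can be its parent.
  no-cycle : ¬ Cycle tree
  no-cycle C = descend zero (<ᶠ-wellFounded _)
    where
    open Cycle C
    descend : ∀ j → ¬ Acc _<_ (vertex j)
    descend j (acc rs) with cycle-nbrs C j
    ... | x , y , x≢y , jx , jy
      with symGraph⁻ childOf? childOf-irrefl jx | symGraph⁻ childOf? childOf-irrefl jy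
    ... | inj₂ xj | _ = descend x (rs (childOf⇒< xj))
    ... | _ | inj₂ yj = descend y (rs (childOf⇒< yj))
    ... | inj₁ (i , i≡ , pi≡) | inj₁ (i′ , i′≡ , pi′≡) = x≢y (injective (trans (sym pi≡)
      (trans (cong parent (inject₁-injective (trans i≡ (sym i′≡)))) pi′≡)))

  tree-isTree : IsTree tree
  tree-isTree = record
    { nonempty  = zero
    ; connected = λ a b → to-root a (>-wellFounded a)
                          ◅◅ reverse (Adj-sym tree) (to-root b (>-wellFounded b))
    ; acyclic   = no-cycle
    }

  -- Each vertex but the root owns the edge to its parent. With `index` as inverse, this numbers the
  -- edges by `Fin k`.
  edgeAt : Fin k → Edge tree
  edgeAt i = edge (inject₁ i) (parent i) (parent-< i)
                  (symGraph⁺ childOf? childOf-irrefl (inj₁ (i , refl , refl)))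

  -- Parents have larger indices and edges point from the smaller to the larger end, so the source
  -- is the child.
  edge-childOf : (e : Edge tree) → ChildOf (Edge.src e) (Edge.tgt e)
  edge-childOf e with symGraph⁻ childOf? childOf-irrefl (Edge.adjacent e)
  ... | inj₁ c = c
  ... | inj₂ c = contradiction (childOf⇒< c) (Fin.<-asym (Edge.ordered e))

  index : Edge tree → Fin k
  index e = proj₁ (edge-childOf e)

  edgeAt-index : ∀ e → edgeAt (index e) ≡ e
  edgeAt-index e with edge-childOf e
  ... | i , src≡ , tgt≡ = Edge-≡ src≡ tgt≡

  index-edgeAt : ∀ i → index (edgeAt i) ≡ i
  index-edgeAt i = inject₁-injective (cong Edge.src (edgeAt-index (edgeAt i)))

  Incident : Fin (suc k) → Fin k → Set
  Incident a i = a ≡ inject₁ i ⊎ a ≡ parent i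

  endpoint⇒incident : ∀ a e → T (endpoint a e) → Incident a (index e)
  endpoint⇒incident a e ae = endpoint⁻ a (edgeAt (index e))
    (subst (λ e′ → T (endpoint a e′)) (sym (edgeAt-index e)) ae)

  incident⇒endpoint : ∀ a e → Incident a (index e) → T (endpoint a e)
  incident⇒endpoint a e inc = subst (λ e′ → T (endpoint a e′)) (edgeAt-index e)
    (endpoint⁺ a (edgeAt (index e)) inc)

-- From an obstruction to a substructure

module _ {n} {G : Graph (Fin n)} {D : Subset n} (O : Obstruction G ⊤ D) where
  open Obstruction O
  open ParentTree parent parent-<

  -- Directed from original to subdividing vertices; `symGraph` adds the reverse direction.
  Inc : Fin n → Fin n → Set
  Inc u v = ∃₂ λ a i → f a ≡ u × g i ≡ v × Incident a i

  inc? : ∀ u v → Dec (Inc u v)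
  inc? u v = any? λ a → any? λ i →
    (f a ≟ u) ×-dec (g i ≟ v) ×-dec ((a ≟ inject₁ i) ⊎-dec (a ≟ parent i))

  inc-irrefl : ∀ v → ¬ Inc v v
  inc-irrefl v (_ , _ , fa≡v , gi≡v , _) = f≢g (trans fa≡v (sym gi≡v))

  Vertex : Fin n → Set
  Vertex v = (∃ λ a → f a ≡ v) ⊎ (∃ λ i → g i ≡ v)

  vertex? : Decidable Vertex
  vertex? v = any? (λ a → f a ≟ v) ⊎-dec any? (λ i → g i ≟ v)

  incGraph : Graph (Fin n)
  incGraph = symGraph inc? inc-irrefl

  inc⇒adj : ∀ {u v} → Inc u v → Adj G u v
  inc⇒adj (_ , i , refl , refl , inj₁ refl) = child-adj i
  inc⇒adj (_ , i , refl , refl , inj₂ refl) = parent-adj i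

  inc⇒vertices : ∀ {u v} → Inc u v → u ∈ subset vertex? × v ∈ subset vertex?
  inc⇒vertices (a , i , fa≡u , gi≡v , _) =
    ∈-subset⁺ vertex? (inj₁ (a , fa≡u)) , ∈-subset⁺ vertex? (inj₂ (i , gi≡v))

  subgraph : Subgraph G
  subgraph = record
    { vertices  = subset vertex?
    ; edges     = incGraph
    ; edges-⊆   = [ inc⇒adj , Adj-sym G ∘ inc⇒adj ]′ ∘ symGraph⁻ inc? inc-irrefl
    ; endpoints = [ inc⇒vertices , (λ vu → proj₂ (inc⇒vertices vu) , proj₁ (inc⇒vertices vu)) ]′
                  ∘ symGraph⁻ inc? inc-irrefl
    }

  to : Fin (suc k) ⊎ Edge tree → ∃ (_∈ subset vertex?)
  to (inj₁ a) = f a , ∈-subset⁺ vertex? (inj₁ (a , refl))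
  to (inj₂ e) = g (index e) , ∈-subset⁺ vertex? (inj₂ (index e , refl))

  to-injective : ∀ s t → proj₁ (to s) ≡ proj₁ (to t) → s ≡ t
  to-injective (inj₁ a) (inj₁ b)  eq = cong inj₁ (f-injective eq)
  to-injective (inj₁ a) (inj₂ e)  eq = contradiction eq f≢g
  to-injective (inj₂ e) (inj₁ a)  eq = contradiction (sym eq) f≢g
  to-injective (inj₂ e) (inj₂ e′) eq = cong inj₂ (trans (sym (edgeAt-index e))
    (trans (cong edgeAt (g-injective eq)) (edgeAt-index e′)))

  to-surjective : ∀ v → Vertex v → ∃ λ s → proj₁ (to s) ≡ v
  to-surjective v (inj₁ (a , fa≡v)) = inj₁ a , fa≡v
  to-surjective v (inj₂ (i , gi≡v)) = inj₂ (edgeAt i) , trans (cong g (index-edgeAt i)) gi≡v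

  preimage : (x : ∃ (_∈ subset vertex?)) → ∃ λ s → proj₁ (to s) ≡ proj₁ x
  preimage (v , v∈) = to-surjective v (∈-subset⁻ vertex? v∈)

  to-bijection : (Fin (suc k) ⊎ Edge tree) ↔ ∃ (_∈ subset vertex?)
  to-bijection = mk↔ₛ′ to (proj₁ ∘ preimage) (λ x → ∃∈-≡ (proj₂ (preimage x)))
    (λ s → to-injective _ s (proj₂ (preimage (to s))))

  endpoint≡ : ∀ a e → endpoint a e ≡ adj incGraph (f a) (g (index e))
  endpoint≡ a e = T-ext
    (λ ae → symGraph⁺ inc? inc-irrefl (inj₁ (a , index e , refl , refl , endpoint⇒incident a e ae)))
    (λ ae → case symGraph⁻ inc? inc-irrefl ae of λ where
      (inj₁ (b , i , fb≡ , gi≡ , inc)) → incident⇒endpoint a e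
        (subst₂ Incident (f-injective fb≡) (g-injective gi≡) inc)
      (inj₂ (_ , _ , fb≡ , _)) → contradiction fb≡ f≢g)

  to-adj : ∀ s t → adj (subdivide tree) s t ≡ adj incGraph (proj₁ (to s)) (proj₁ (to t))
  to-adj (inj₁ a) (inj₁ b) = T-ext (λ ()) λ ab → case symGraph⁻ inc? inc-irrefl ab of λ where
    (inj₁ (_ , _ , _ , gi≡ , _)) → f≢g (sym gi≡)
    (inj₂ (_ , _ , _ , gi≡ , _)) → f≢g (sym gi≡)
  to-adj (inj₁ a) (inj₂ e) = endpoint≡ a e
  to-adj (inj₂ e) (inj₁ a) = trans (endpoint≡ a e) (adj-sym incGraph (f a) (g (index e)))
  to-adj (inj₂ e) (inj₂ e′) = T-ext (λ ()) λ ee′ → case symGraph⁻ inc? inc-irrefl ee′ of λ where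
    (inj₁ (_ , _ , fa≡ , _)) → f≢g fa≡
    (inj₂ (_ , _ , fa≡ , _)) → f≢g fa≡

  obstruction⇒substructure : Σ (Substructure G) λ F → ∀ v → Substructure.X F v → v ∉ D
  obstruction⇒substructure =
    record
      { F     = subgraph
      ; F∈𝒮   = record
        { order  = suc k
        ; tree   = tree
        ; isTree = tree-isTree
        ; iso    = record { bijection = to-bijection ; adj-≡ = to-adj }
        }
      -- For `A = ⊤`, `closed` says that an original vertex keeps all its neighbours in the
      -- subgraph, so the neighbourhoods agree and with them the degrees.
      ; deg-≡ = λ { v (a , refl) → cong ∣_∣ (tabulate-cong (nbhd≡ a)) }
      }
    , λ { v (a , refl) → f∉D a }
    where
    nbhd≡ : ∀ a w → adj G (f a) w ≡ adj incGraph (f a) w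
    nbhd≡ a w = T-ext
      (λ aw → let i , gi≡w , inc = closed a w ∈⊤ aw in
        symGraph⁺ inc? inc-irrefl (inj₁ (a , i , refl , gi≡w , inc)))
      (Subgraph.edges-⊆ subgraph)

-- From a substructure to a win for Staller

module _ {n} {G : Graph (Fin n)} {D : Subset n} (S : Substructure G)
         (X∉D : ∀ v → Substructure.X S v → v ∉ D) where
  open Substructure S using (F; F∈𝒮; deg-≡)
  open Subgraph F
  open 𝒮 F∈𝒮 using (order; tree; isTree; iso)
  open _≅_ iso using (bijection; adj-≡) renaming (to to embed)

  embed-injective : ∀ {s t} → proj₁ (embed s) ≡ proj₁ (embed t) → s ≡ t
  embed-injective {s} {t} eq = trans (sym (Inverse.strictlyInverseʳ bijection s))
    (trans (cong (Inverse.from bijection) (∃∈-≡ eq)) (Inverse.strictlyInverseʳ bijection t))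

  -- Equal degrees make the neighbourhoods in G and in F coincide, so w is a neighbour within F; in
  -- a subdivision an original vertex meets only subdividing ones.
  embed-closed : ∀ a w → Adj G (proj₁ (embed (inj₁ a))) w →
    ∃ λ e → T (endpoint a e) × proj₁ (embed (inj₂ e)) ≡ w
  embed-closed a w aw = go (Inverse.from bijection (w , w∈))
    (cong proj₁ (Inverse.strictlyInverseˡ bijection (w , w∈)))
    where
    fa = proj₁ (embed (inj₁ a))

    aw-edge : Adj edges fa w
    aw-edge = ∈-openNbhd⁻ {G = edges} (⊆∧∣∣≡⇒⊇
      (λ v∈ → ∈-openNbhd⁺ {G = G} (edges-⊆ (∈-openNbhd⁻ {G = edges} v∈)))
      (deg-≡ fa (a , refl)) (∈-openNbhd⁺ {G = G} aw))

    w∈ : w ∈ vertices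
    w∈ = proj₂ (endpoints aw-edge)

    go : ∀ s → proj₁ (embed s) ≡ w → ∃ λ e → T (endpoint a e) × proj₁ (embed (inj₂ e)) ≡ w
    go (inj₁ b) refl = contradiction (subst T (sym (adj-≡ (inj₁ a) (inj₁ b))) aw-edge) λ ()
    go (inj₂ e) refl = e , subst T (sym (adj-≡ (inj₁ a) (inj₂ e))) aw-edge , refl

  substructure⇒wins : StallerWins G D
  substructure⇒wins = peeling-wins G D tree (IsTree.acyclic isTree)
    (λ a → proj₁ (embed (inj₁ a))) (λ e → proj₁ (embed (inj₂ e)))
    (λ eq → case embed-injective eq of λ { refl → refl })
    (λ eq → case embed-injective eq of λ ())
    (λ a → X∉D _ (a , refl))
    embed-closed
    (IsTree.nonempty isTree)

theorem4p5 : (n : ℕ) (T : Graph (Fin n)) (D : Subset n) → IsTree T →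
    StallerWins T D ⇔ Σ (Substructure T) (λ F → ∀ v → Substructure.X F v → v ∉ D)
theorem4p5 n T D isTree = mk⇔
  (λ wins → [ (λ M → contradiction wins (pairing-wins M)) , obstruction⇒substructure ]′
    (matching-or-obstruction T (IsTree.acyclic isTree) ⊤ D (⊂-wellFounded ⊤)))
  (λ (F , X∉D) → substructure⇒wins F X∉D)
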